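{- Let $k\ge1$ be an integer and let $P=(E,r)$ be a $k$-polymatroid. (i) If $k$ is odd, then $$T_k(P;x+1,y+1)=\sum_{A\subseteq E}T_k(P|_A;0,y+1)\,T_k(P/A;x+1,0).$$ (ii) If $k$ is even, then both $$T_k(P;x+1,y+1)=\sum_{A\subseteq E}(-1)^{r(P|_A)}\,\chi\big((P|_A)^*;-y\big)\,T_k(P/A;x+1,0)$$ and $$T_k(P;x+1,y+1)=\sum_{A\subseteq E}(-1)^{r(P/A)}\,T_k(P|_A;0,y+1)\,\chi(P/A;-x).$$
   Context: A polymatroid is a pair $P=(E,r)$ with $E$ a finite set and $r:2^E\to\mathbb{Z}$ such that $r(\emptyset)=0$, $r(A)\le r(B)$ whenever $A\subseteq B$, and $r(A)+r(B)\ge r(A\cup B)+r(A\cap B)$ for all $A,B\subseteq E$. It is a $k$-polymatroid if $r(\{e\})\le k$ for all $e\in E$. For a polymatroid $Q$, $r(Q)$ denotes the rank of its whole groundset. Restriction: $P|_A=(A,r|_{2^A})$. Contraction: $P/A=(E\setminus A,r_{P/A})$ with $r_{P/A}(X)=r(X\cup A)-r(A)$. The $k$-dual of a $k$-polymatroid $P=(E,r)$ is $P^*=(E,r^*)$ with $r^*(A)=k|A|+r(E\setminus A)-r(E)$. $k$-polymatroid Tutte polynomial: $T_k(P;x,y)=\sum_{A\subseteq E}(x-1)^{r(E)-r(A)}(y-1)^{k|A|-r(A)}$. Characteristic polynomial: $\chi(P;x)=\sum_{A\subseteq E}(-1)^{|A|}x^{r(E)-r(A)}$. -}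

module Defs where

open import Algebra.Bundles using (CommutativeRing)
import Algebra.Properties.Semiring.Exp as Exp
open import Data.Bool.Base using (true; false)
open import Data.Bool.Properties using (∨-identityʳ; ∨-zeroʳ)
open import Data.Fin.Base using (Fin; zero; suc)
open import Data.Fin.Subset hiding (_-_)
open import Data.Fin.Subset.Properties
open import Data.Integer.Base as ℤ using (ℤ; +_; 0ℤ)
import Data.Integer.Properties as ℤ
open import Data.Integer.Tactic.RingSolver using (solve-∀)
open import Data.Nat.Base as ℕ using (ℕ; zero; suc)
import Data.Nat.Properties as ℕ
open import Data.Sum.Base using ([_,_]′)
open import Data.Vec.Base using ([]; _∷_; here; there)
open import Function.Base using (_∘_)
open import Relation.Binary.PropositionalEquality
  using (_≡_; refl; sym; trans; cong; cong₂; subst; subst₂)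
open import Relation.Nullary.Negation using (contradiction)

private
  variable
    n k : ℕ

-- The ground set is a subset of Fin n rather than all of Fin n, so that
-- restrictions and contractions live on subsets of the same universe.
-- Only the values of `rank` at subsets of `ground` are meaningful; the
-- other values are never constrained and never used.

record RankedSet (n : ℕ) : Set where
  constructor ⟨_,_⟩
  field
    ground : Subset n
    rank   : Subset n → ℤ

  totalRank : ℤ
  totalRank = rank ground

open RankedSet public

record IsPolymatroid (P : RankedSet n) : Set where
  field
    rank-∅     : rank P ⊥ ≡ 0ℤ
    monotone   : ∀ A B → A ⊆ B → B ⊆ ground P → rank P A ℤ.≤ rank P B
    submodular : ∀ A B → A ⊆ ground P → B ⊆ ground P →
                 rank P (A ∪ B) ℤ.+ rank P (A ∩ B) ℤ.≤ rank P A ℤ.+ rank P B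

record IsKPolymatroid (k : ℕ) (P : RankedSet n) : Set where
  field
    isPolymatroid : IsPolymatroid P
    rank-⁅⁆       : ∀ e → e ∈ ground P → rank P ⁅ e ⁆ ℤ.≤ + k

  open IsPolymatroid isPolymatroid public

infixl 6 _∣ʳ_ _/ᶜ_

_∣ʳ_ : RankedSet n → Subset n → RankedSet n
P ∣ʳ A = ⟨ A , rank P ⟩

_/ᶜ_ : RankedSet n → Subset n → RankedSet n
P /ᶜ A = ⟨ ground P ─ A , (λ X → rank P (X ∪ A) ℤ.- rank P A) ⟩

dual : ℕ → RankedSet n → RankedSet n
dual k P =
  ⟨ ground P
  , (λ A → + (k ℕ.* ∣ A ∣) ℤ.+ rank P (ground P ─ A) ℤ.- totalRank P) ⟩

-- Polynomials in ℤ[x] and ℤ[x,y] are represented by their evaluations at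
-- elements of an arbitrary commutative ring; an identity holding in every
-- commutative ring holds in particular for the indeterminates of ℤ[x,y].

module Polynomials {c ℓ} (R : CommutativeRing c ℓ) where
  open CommutativeRing R
  open Exp semiring using (_^_) public

  -- The sum of f A over all A ⊆ E, each subset occurring exactly once.
  ∑⊆ : Subset n → (Subset n → Carrier) → Carrier
  ∑⊆ []            f = f []
  ∑⊆ (outside ∷ E) f = ∑⊆ E (λ A → f (outside ∷ A))
  ∑⊆ (inside  ∷ E) f = ∑⊆ E (λ A → f (outside ∷ A)) + ∑⊆ E (λ A → f (inside ∷ A))

  infixr 8 _^ℤ_

  -- Used only with i ≥ 0 (see the exponent lemmas below), where + ℤ.∣ i ∣ ≡ i.
  _^ℤ_ : Carrier → ℤ → Carrier
  x ^ℤ i = x ^ ℤ.∣ i ∣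

  T : ℕ → RankedSet n → Carrier → Carrier → Carrier
  T k P x y = ∑⊆ (ground P) λ A →
    (x - 1#) ^ℤ (totalRank P ℤ.- rank P A) * (y - 1#) ^ℤ (+ (k ℕ.* ∣ A ∣) ℤ.- rank P A)

  χ : RankedSet n → Carrier → Carrier
  χ P x = ∑⊆ (ground P) λ A →
    (- 1#) ^ ∣ A ∣ * x ^ℤ (totalRank P ℤ.- rank P A)

------------------------------------------------------------------------
-- The exponents occurring in T, χ and (-1)^r are nonnegative, and
-- restriction, contraction and dual preserve k-polymatroids.

private
  ─-∪-split : (E A B : Subset n) → A ⊆ B → B ⊆ E → E ─ A ≡ (E ─ B) ∪ (B ─ A)
  ─-∪-split []            []            []            _ _ = refl
  ─-∪-split (e ∷ E)       (inside ∷ A)  (outside ∷ B) p q = contradiction (p here) λ ()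
  ─-∪-split (outside ∷ E) (a ∷ A)       (inside ∷ B)  p q = contradiction (q here) λ ()
  ─-∪-split (outside ∷ E) (outside ∷ A) (outside ∷ B) p q = cong (_ ∷_) (─-∪-split E A B (drop-∷-⊆ p) (drop-∷-⊆ q))
  ─-∪-split (inside ∷ E)  (outside ∷ A) (outside ∷ B) p q = cong (_ ∷_) (─-∪-split E A B (drop-∷-⊆ p) (drop-∷-⊆ q))
  ─-∪-split (inside ∷ E)  (outside ∷ A) (inside ∷ B)  p q = cong (_ ∷_) (─-∪-split E A B (drop-∷-⊆ p) (drop-∷-⊆ q))
  ─-∪-split (inside ∷ E)  (inside ∷ A)  (inside ∷ B)  p q = cong (_ ∷_) (─-∪-split E A B (drop-∷-⊆ p) (drop-∷-⊆ q))

  ∣─∣-split : (A B : Subset n) → A ⊆ B → ∣ A ∣ ℕ.+ ∣ B ─ A ∣ ≡ ∣ B ∣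
  ∣─∣-split []            []            p = refl
  ∣─∣-split (inside ∷ A)  (outside ∷ B) p = contradiction (p here) λ ()
  ∣─∣-split (outside ∷ A) (outside ∷ B) p = ∣─∣-split A B (drop-∷-⊆ p)
  ∣─∣-split (inside ∷ A)  (inside ∷ B)  p = cong suc (∣─∣-split A B (drop-∷-⊆ p))
  ∣─∣-split (outside ∷ A) (inside ∷ B)  p =
    trans (ℕ.+-suc _ _) (cong suc (∣─∣-split A B (drop-∷-⊆ p)))

  ∣∪∣+∣∩∣ : (A B : Subset n) → ∣ A ∪ B ∣ ℕ.+ ∣ A ∩ B ∣ ≡ ∣ A ∣ ℕ.+ ∣ B ∣
  ∣∪∣+∣∩∣ []            []            = refl
  ∣∪∣+∣∩∣ (outside ∷ A) (outside ∷ B) = ∣∪∣+∣∩∣ A B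
  ∣∪∣+∣∩∣ (inside ∷ A)  (outside ∷ B) = cong suc (∣∪∣+∣∩∣ A B)
  ∣∪∣+∣∩∣ (outside ∷ A) (inside ∷ B)  =
    trans (cong suc (∣∪∣+∣∩∣ A B)) (sym (ℕ.+-suc _ _))
  ∣∪∣+∣∩∣ (inside ∷ A)  (inside ∷ B)  =
    cong suc (trans (ℕ.+-suc _ _) (trans (cong suc (∣∪∣+∣∩∣ A B)) (sym (ℕ.+-suc _ _))))

  ─-∪ : (E A B : Subset n) → E ─ (A ∪ B) ≡ (E ─ A) ∩ (E ─ B)
  ─-∪ []            []            []            = refl
  ─-∪ (outside ∷ E) (inside ∷ A)  (b ∷ B)       = cong (_ ∷_) (─-∪ E A B)
  ─-∪ (outside ∷ E) (outside ∷ A) (inside ∷ B)  = cong (_ ∷_) (─-∪ E A B)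
  ─-∪ (outside ∷ E) (outside ∷ A) (outside ∷ B) = cong (_ ∷_) (─-∪ E A B)
  ─-∪ (inside ∷ E)  (inside ∷ A)  (b ∷ B)       = cong (_ ∷_) (─-∪ E A B)
  ─-∪ (inside ∷ E)  (outside ∷ A) (inside ∷ B)  = cong (_ ∷_) (─-∪ E A B)
  ─-∪ (inside ∷ E)  (outside ∷ A) (outside ∷ B) = cong (_ ∷_) (─-∪ E A B)

  ─-∩ : (E A B : Subset n) → E ─ (A ∩ B) ≡ (E ─ A) ∪ (E ─ B)
  ─-∩ []            []            []            = refl
  ─-∩ (outside ∷ E) (inside ∷ A)  (inside ∷ B)  = cong (_ ∷_) (─-∩ E A B)
  ─-∩ (outside ∷ E) (inside ∷ A)  (outside ∷ B) = cong (_ ∷_) (─-∩ E A B)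
  ─-∩ (outside ∷ E) (outside ∷ A) (inside ∷ B)  = cong (_ ∷_) (─-∩ E A B)
  ─-∩ (outside ∷ E) (outside ∷ A) (outside ∷ B) = cong (_ ∷_) (─-∩ E A B)
  ─-∩ (inside ∷ E)  (inside ∷ A)  (inside ∷ B)  = cong (_ ∷_) (─-∩ E A B)
  ─-∩ (inside ∷ E)  (inside ∷ A)  (outside ∷ B) = cong (_ ∷_) (─-∩ E A B)
  ─-∩ (inside ∷ E)  (outside ∷ A) (inside ∷ B)  = cong (_ ∷_) (─-∩ E A B)
  ─-∩ (inside ∷ E)  (outside ∷ A) (outside ∷ B) = cong (_ ∷_) (─-∩ E A B)

  ─-self : (E : Subset n) → E ─ E ≡ ⊥
  ─-self []            = refl
  ─-self (inside ∷ E)  = cong (_ ∷_) (─-self E)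
  ─-self (outside ∷ E) = cong (_ ∷_) (─-self E)

  ∪-lub : {A B C : Subset n} → A ⊆ C → B ⊆ C → A ∪ B ⊆ C
  ∪-lub {A = A} {B} p q x∈ = [ p , q ]′ (x∈p∪q⁻ A B x∈)

  ⁅⁆⊆ : {A : Subset n} {e : Fin n} → e ∈ A → ⁅ e ⁆ ⊆ A
  ⁅⁆⊆ {A = A} {e} e∈A x∈ = subst (_∈ A) (sym (x∈⁅y⁆⇒x≡y e x∈)) e∈A

  ∪-monoˡ-⊆ : {A B : Subset n} (C : Subset n) → A ⊆ B → A ∪ C ⊆ B ∪ C
  ∪-monoˡ-⊆ {A = A} {B} C p = ∪-lub (p⊆p∪q {p = B} C ∘ p) (q⊆p∪q B C)

  -- Adding a set B one element at a time raises g by at most k per element.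
  grow : ∀ k (g : Subset n → ℤ) (E : Subset n) →
         (∀ A e → A ⊆ E → e ∈ E → g (A ∪ ⁅ e ⁆) ℤ.≤ g A ℤ.+ + k) →
         ∀ A B → A ⊆ E → B ⊆ E → g (A ∪ B) ℤ.≤ g A ℤ.+ + (k ℕ.* ∣ B ∣)
  grow k g [] h [] [] p q =
    ℤ.≤-reflexive (trans (sym (ℤ.+-identityʳ _)) (cong (λ z → g [] ℤ.+ + z) (sym (ℕ.*-zeroʳ k))))
  grow {suc n} k g (s ∷ E) h (a ∷ A) (b ∷ B) p q = body a b p q
    where
    rec : ∀ c → (c ∷ A ⊆ s ∷ E) → g (c ∷ (A ∪ B)) ℤ.≤ g (c ∷ A) ℤ.+ + (k ℕ.* ∣ B ∣)
    rec c cA⊆ = grow k (λ X → g (c ∷ X)) E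
      (λ X e X⊆ e∈ →
        subst (λ d → g (d ∷ (X ∪ ⁅ e ⁆)) ℤ.≤ g (c ∷ X) ℤ.+ + k) (∨-identityʳ c)
          (h (c ∷ X) (suc e) (cons X⊆) (there e∈)))
      A B (drop-∷-⊆ p) (drop-∷-⊆ q)
      where
      cons : ∀ {X} → X ⊆ E → c ∷ X ⊆ s ∷ E
      cons X⊆ here with cA⊆ here
      ... | here = here
      cons X⊆ (there x∈) = there (X⊆ x∈)

    add : ∀ a → (a ∷ A ⊆ s ∷ E) → (inside ∷ B ⊆ s ∷ E) →
          g (inside ∷ A) ℤ.≤ g (a ∷ A) ℤ.+ + k
    add a aA⊆ iB⊆ = subst (λ X → g X ℤ.≤ g (a ∷ A) ℤ.+ + k)
      (cong₂ _∷_ (∨-zeroʳ a) (∪-identityʳ A)) (h (a ∷ A) zero aA⊆ (iB⊆ here))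

    in⊆ : ∀ {a} → (a ∷ A ⊆ s ∷ E) → (inside ∷ B ⊆ s ∷ E) → inside ∷ A ⊆ s ∷ E
    in⊆ p q here       = q here
    in⊆ p q (there x∈) = p (there x∈)

    inside-case : ∀ a → (a ∷ A ⊆ s ∷ E) → (inside ∷ B ⊆ s ∷ E) →
      g (inside ∷ (A ∪ B)) ℤ.≤ g (a ∷ A) ℤ.+ + (k ℕ.* suc ∣ B ∣)
    inside-case a p q = begin
      g (inside ∷ (A ∪ B))                          ≤⟨ rec inside (in⊆ p q) ⟩
      g (inside ∷ A) ℤ.+ + (k ℕ.* ∣ B ∣)            ≤⟨ ℤ.+-monoˡ-≤ _ (add a p q) ⟩
      g (a ∷ A) ℤ.+ + k ℤ.+ + (k ℕ.* ∣ B ∣)         ≡⟨ ℤ.+-assoc (g (a ∷ A)) (+ k) _ ⟩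
      g (a ∷ A) ℤ.+ + (k ℕ.+ k ℕ.* ∣ B ∣)           ≡⟨ cong (λ z → g (a ∷ A) ℤ.+ + z) (sym (ℕ.*-suc k ∣ B ∣)) ⟩
      g (a ∷ A) ℤ.+ + (k ℕ.* suc ∣ B ∣)             ∎
      where open ℤ.≤-Reasoning

    body : ∀ a b → (a ∷ A ⊆ s ∷ E) → (b ∷ B ⊆ s ∷ E) →
           g ((a ∷ A) ∪ (b ∷ B)) ℤ.≤ g (a ∷ A) ℤ.+ + (k ℕ.* ∣ b ∷ B ∣)
    body true  false p q = rec true p
    body false false p q = rec false p
    body true  true  p q = inside-case true p q
    body false true  p q = inside-case false p q

  0≤+ : ∀ {i j} → 0ℤ ℤ.≤ i → 0ℤ ℤ.≤ j → 0ℤ ℤ.≤ i ℤ.+ j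
  0≤+ = ℤ.+-mono-≤

module KPolymatroidProperties {n k} {P : RankedSet n} (isK : IsKPolymatroid k P) where
  open IsKPolymatroid isK

  private
    E = ground P
    r = rank P

  rank-nonneg : ∀ A → A ⊆ E → 0ℤ ℤ.≤ r A
  rank-nonneg A A⊆E = subst (ℤ._≤ r A) rank-∅ (monotone ⊥ A ⊥⊆ A⊆E)

  rank-∪≤ : ∀ A B → A ⊆ E → B ⊆ E → r (A ∪ B) ℤ.≤ r A ℤ.+ + (k ℕ.* ∣ B ∣)
  rank-∪≤ = grow k r E λ A e A⊆ e∈ →
    ℤ.≤-trans
      (subst (ℤ._≤ r (A ∪ ⁅ e ⁆) ℤ.+ r (A ∩ ⁅ e ⁆)) (ℤ.+-identityʳ _)
        (ℤ.+-monoʳ-≤ (r (A ∪ ⁅ e ⁆)) (rank-nonneg _ (A⊆ ∘ p∩q⊆p A ⁅ e ⁆))))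
      (ℤ.≤-trans (submodular A ⁅ e ⁆ A⊆ (⁅⁆⊆ e∈)) (ℤ.+-monoʳ-≤ (r A) (rank-⁅⁆ e e∈)))

  rank≤k∣A∣ : ∀ A → A ⊆ E → r A ℤ.≤ + (k ℕ.* ∣ A ∣)
  rank≤k∣A∣ A A⊆E = subst₂ ℤ._≤_ (cong r (∪-identityˡ A))
    (trans (cong (ℤ._+ + (k ℕ.* ∣ A ∣)) rank-∅) (ℤ.+-identityˡ _)) (rank-∪≤ ⊥ A ⊥⊆ A⊆E)

  corank-exponent : ∀ A → A ⊆ E → + ℤ.∣ totalRank P ℤ.- r A ∣ ≡ totalRank P ℤ.- r A
  corank-exponent A A⊆E = ℤ.0≤i⇒+∣i∣≡i (ℤ.i≤j⇒0≤j-i (monotone A E A⊆E ⊆-refl))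

  nullity-exponent : ∀ A → A ⊆ E →
    + ℤ.∣ + (k ℕ.* ∣ A ∣) ℤ.- r A ∣ ≡ + (k ℕ.* ∣ A ∣) ℤ.- r A
  nullity-exponent A A⊆E = ℤ.0≤i⇒+∣i∣≡i (ℤ.i≤j⇒0≤j-i (rank≤k∣A∣ A A⊆E))

  totalRank-exponent : + ℤ.∣ totalRank P ∣ ≡ totalRank P
  totalRank-exponent = ℤ.0≤i⇒+∣i∣≡i (rank-nonneg E ⊆-refl)

  ∣ʳ-isKPolymatroid : ∀ A → A ⊆ E → IsKPolymatroid k (P ∣ʳ A)
  ∣ʳ-isKPolymatroid A A⊆E = record
    { isPolymatroid = record
      { rank-∅     = rank-∅
      ; monotone   = λ X Y p q → monotone X Y p (⊆-trans q A⊆E)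
      ; submodular = λ X Y p q → submodular X Y (⊆-trans p A⊆E) (⊆-trans q A⊆E)
      }
    ; rank-⁅⁆ = λ e e∈ → rank-⁅⁆ e (A⊆E e∈)
    }

  /ᶜ-isKPolymatroid : ∀ A → A ⊆ E → IsKPolymatroid k (P /ᶜ A)
  /ᶜ-isKPolymatroid A A⊆E = record
    { isPolymatroid = record
      { rank-∅     = trans (cong (λ X → r X ℤ.- r A) (∪-identityˡ A)) (ℤ.+-inverseʳ (r A))
      ; monotone   = λ X Y p q → ℤ.+-monoˡ-≤ (ℤ.- r A)
          (monotone (X ∪ A) (Y ∪ A) (∪-monoˡ-⊆ A p) (sub q))
      ; submodular = λ X Y p q → ℤ.0≤i-j⇒j≤i
          (subst (0ℤ ℤ.≤_) (alg (r (X ∪ A)) (r (Y ∪ A)) (r ((X ∪ Y) ∪ A)) (r ((X ∩ Y) ∪ A)) (r A))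
            (ℤ.i≤j⇒0≤j-i
              (subst₂ (λ U V → r U ℤ.+ r V ℤ.≤ r (X ∪ A) ℤ.+ r (Y ∪ A))
                (union X Y) (sym (∪-distribʳ-∩ A X Y))
                (submodular (X ∪ A) (Y ∪ A) (sub p) (sub q)))))
      }
    ; rank-⁅⁆ = λ e e∈ → ℤ.0≤i-j⇒j≤i
        (subst (0ℤ ℤ.≤_) (alg₂ (r A) (+ k) (r (⁅ e ⁆ ∪ A)))
          (ℤ.i≤j⇒0≤j-i
            (subst₂ (λ U m → r U ℤ.≤ r A ℤ.+ + m)
              (∪-comm A ⁅ e ⁆) (trans (cong (k ℕ.*_) (∣⁅x⁆∣≡1 e)) (ℕ.*-identityʳ k))
              (rank-∪≤ A ⁅ e ⁆ A⊆E (⁅⁆⊆ (p─q⊆p E A e∈))))))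
    }
    where
    sub : ∀ {X} → X ⊆ E ─ A → X ∪ A ⊆ E
    sub p = ∪-lub (p─q⊆p E A ∘ p) A⊆E

    union : ∀ X Y → (X ∪ A) ∪ (Y ∪ A) ≡ (X ∪ Y) ∪ A
    union X Y = ⊆-antisym
      (∪-lub (∪-monoˡ-⊆ A (p⊆p∪q Y)) (∪-monoˡ-⊆ A (q⊆p∪q X Y)))
      (∪-lub (∪-lub (p⊆p∪q (Y ∪ A) ∘ p⊆p∪q A) (q⊆p∪q (X ∪ A) (Y ∪ A) ∘ p⊆p∪q A))
             (p⊆p∪q (Y ∪ A) ∘ q⊆p∪q X A))

    alg : ∀ a b c d e → (a ℤ.+ b) ℤ.- (c ℤ.+ d)
        ≡ ((a ℤ.- e) ℤ.+ (b ℤ.- e)) ℤ.- ((c ℤ.- e) ℤ.+ (d ℤ.- e))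
    alg = solve-∀

    alg₂ : ∀ a b c → (a ℤ.+ b) ℤ.- c ≡ b ℤ.- (c ℤ.- a)
    alg₂ = solve-∀

  dual-isKPolymatroid : IsKPolymatroid k (dual k P)
  dual-isKPolymatroid = record
    { isPolymatroid = record
      { rank-∅     = rank*-∅
      ; monotone   = λ A B A⊆B B⊆E → ℤ.+-monoˡ-≤ (ℤ.- totalRank P) (begin
          + (k ℕ.* ∣ A ∣) ℤ.+ r (E ─ A)
            ≡⟨ cong (λ X → + (k ℕ.* ∣ A ∣) ℤ.+ r X) (─-∪-split E A B A⊆B B⊆E) ⟩
          + (k ℕ.* ∣ A ∣) ℤ.+ r ((E ─ B) ∪ (B ─ A))
            ≤⟨ ℤ.+-monoʳ-≤ (+ (k ℕ.* ∣ A ∣))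
                 (rank-∪≤ (E ─ B) (B ─ A) (p─q⊆p E B) (B⊆E ∘ p─q⊆p B A)) ⟩
          + (k ℕ.* ∣ A ∣) ℤ.+ (r (E ─ B) ℤ.+ + (k ℕ.* ∣ B ─ A ∣))
            ≡⟨ shuffle (+ (k ℕ.* ∣ A ∣)) (r (E ─ B)) (+ (k ℕ.* ∣ B ─ A ∣)) ⟩
          + (k ℕ.* ∣ A ∣ ℕ.+ k ℕ.* ∣ B ─ A ∣) ℤ.+ r (E ─ B)
            ≡⟨ cong (λ m → + m ℤ.+ r (E ─ B))
                 (trans (sym (ℕ.*-distribˡ-+ k ∣ A ∣ _)) (cong (k ℕ.*_) (∣─∣-split A B A⊆B))) ⟩
          + (k ℕ.* ∣ B ∣) ℤ.+ r (E ─ B) ∎)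
      ; submodular = λ A B A⊆E B⊆E → ℤ.0≤i-j⇒j≤i (subst (0ℤ ℤ.≤_)
          (alg (+ (k ℕ.* ∣ A ∣)) (+ (k ℕ.* ∣ B ∣)) (+ (k ℕ.* ∣ A ∪ B ∣)) (+ (k ℕ.* ∣ A ∩ B ∣)) (r (E ─ A)) (r (E ─ B))
             (r (E ─ (A ∪ B))) (r (E ─ (A ∩ B))) (totalRank P))
          (0≤+ (ℤ.≤-reflexive (sym (ℤ.i≡j⇒i-j≡0 (cong +_ (sizes A B)))))
               (ℤ.i≤j⇒0≤j-i
                 (subst₂ (λ U V → r U ℤ.+ r V ℤ.≤ r (E ─ A) ℤ.+ r (E ─ B))
                   (sym (─-∩ E A B)) (sym (─-∪ E A B))
                   (submodular (E ─ A) (E ─ B) (p─q⊆p E A) (p─q⊆p E B))))))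
      }
    ; rank-⁅⁆ = λ e e∈ → ℤ.0≤i-j⇒j≤i (subst (0ℤ ℤ.≤_)
        (trans (alg₂ (+ k) (r (E ─ ⁅ e ⁆)) (totalRank P))
          (cong (λ m → + k ℤ.- (+ m ℤ.+ r (E ─ ⁅ e ⁆) ℤ.- totalRank P))
            (sym (trans (cong (k ℕ.*_) (∣⁅x⁆∣≡1 e)) (ℕ.*-identityʳ k)))))
        (ℤ.i≤j⇒0≤j-i (monotone (E ─ ⁅ e ⁆) E (p─q⊆p E ⁅ e ⁆) ⊆-refl)))
    }
    where
    open ℤ.≤-Reasoning

    rank*-∅ : rank (dual k P) ⊥ ≡ 0ℤ
    rank*-∅ = trans
      (cong₂ (λ m X → + m ℤ.+ r X ℤ.- r E)
        (trans (cong (k ℕ.*_) (∣⊥∣≡0 n)) (ℕ.*-zeroʳ k)) (p─⊥≡p E))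
      (trans (cong (ℤ._- r E) (ℤ.+-identityˡ (r E))) (ℤ.+-inverseʳ (r E)))

    shuffle : ∀ a b c → a ℤ.+ (b ℤ.+ c) ≡ (a ℤ.+ c) ℤ.+ b
    shuffle = solve-∀

    sizes : ∀ A B → k ℕ.* ∣ A ∣ ℕ.+ k ℕ.* ∣ B ∣ ≡ k ℕ.* ∣ A ∪ B ∣ ℕ.+ k ℕ.* ∣ A ∩ B ∣
    sizes A B = trans (sym (ℕ.*-distribˡ-+ k ∣ A ∣ _))
      (trans (cong (k ℕ.*_) (sym (∣∪∣+∣∩∣ A B))) (ℕ.*-distribˡ-+ k ∣ A ∪ B ∣ _))

    alg : ∀ a b c d u v w z t →
      ((a ℤ.+ b) ℤ.- (c ℤ.+ d)) ℤ.+ ((u ℤ.+ v) ℤ.- (z ℤ.+ w))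
      ≡ ((a ℤ.+ u ℤ.- t) ℤ.+ (b ℤ.+ v ℤ.- t)) ℤ.- ((c ℤ.+ w ℤ.- t) ℤ.+ (d ℤ.+ z ℤ.- t))
    alg = solve-∀

    alg₂ : ∀ a b c → c ℤ.- b ≡ a ℤ.- (a ℤ.+ b ℤ.- c)
    alg₂ = solve-∀

{-# OPTIONS --safe #-}
-- Expanding the products turns each right-hand side into a sum over B ⊆ A ⊆ D ⊆ E
-- of x ^ (r E − r D) * y ^ (k |B| − r B), with a sign that equals (-1)^(|D| − |A|)
-- up to a factor depending only on B and D and trivial when B = D. The alternating
-- sum over the interval [B , D] vanishes unless B = D, so only the diagonal terms,
-- which are those of T k P (x + 1) (y + 1), survive.
module Submission where

open import Defs
open import Algebra.Bundles using (CommutativeRing)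
import Algebra.Properties.CommutativeSemiring.Exp as CommutativeExp
import Algebra.Properties.CommutativeSemigroup as CommutativeSemigroupProperties
import Algebra.Properties.Group as GroupProperties
import Algebra.Properties.AbelianGroup as AbelianGroupProperties
import Algebra.Properties.Ring as RingProperties
open import Data.Fin.Subset using (Subset; inside; outside; _⊆_; _∪_; _─_; ∣_∣; ⊥)
open import Data.Fin.Subset.Properties
open import Data.Integer.Base as ℤ using (ℤ; +_; -[1+_]; 0ℤ)
import Data.Integer.Properties as ℤ
open import Data.Integer.Tactic.RingSolver using (solve-∀)
open import Data.Nat.Base as ℕ using (ℕ; zero; suc; _≤_)
open import Data.Nat.Divisibility using (_∣_; _∤_; divides; m%n≡0⇒n∣m)
open import Data.Nat.DivMod using (_%_; _/_; m≡m%n+[m/n]*n; m%n<n)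
import Data.Nat.Properties as ℕ
import Data.Nat.Tactic.RingSolver as ℕSolver
open import Data.Product.Base using (_×_; _,_; ∃)
open import Data.Vec.Base using ([]; _∷_; here)
open import Function.Base using (_∘_; id)
open import Relation.Binary.PropositionalEquality as ≡ using (_≡_; refl; cong; cong₂)
import Relation.Binary.Reasoning.Setoid as SetoidReasoning
open import Relation.Nullary.Negation using (contradiction)

private
  variable
    n : ℕ

-- Finite subsets

p─[p─q]≡q : (p q : Subset n) → q ⊆ p → p ─ (p ─ q) ≡ q
p─[p─q]≡q []            []            _   = refl
p─[p─q]≡q (outside ∷ p) (inside ∷ q)  q⊆p = contradiction (q⊆p here) λ ()
p─[p─q]≡q (outside ∷ p) (outside ∷ q) q⊆p = cong (_ ∷_) (p─[p─q]≡q p q (drop-∷-⊆ q⊆p))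
p─[p─q]≡q (inside ∷ p)  (outside ∷ q) q⊆p = cong (_ ∷_) (p─[p─q]≡q p q (drop-∷-⊆ q⊆p))
p─[p─q]≡q (inside ∷ p)  (inside ∷ q)  q⊆p = cong (_ ∷_) (p─[p─q]≡q p q (drop-∷-⊆ q⊆p))

[p─q]∪q≡p : (p q : Subset n) → q ⊆ p → (p ─ q) ∪ q ≡ p
[p─q]∪q≡p []            []            _   = refl
[p─q]∪q≡p (outside ∷ p) (inside ∷ q)  q⊆p = contradiction (q⊆p here) λ ()
[p─q]∪q≡p (outside ∷ p) (outside ∷ q) q⊆p = cong (_ ∷_) ([p─q]∪q≡p p q (drop-∷-⊆ q⊆p))
[p─q]∪q≡p (inside ∷ p)  (outside ∷ q) q⊆p = cong (_ ∷_) ([p─q]∪q≡p p q (drop-∷-⊆ q⊆p))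
[p─q]∪q≡p (inside ∷ p)  (inside ∷ q)  q⊆p = cong (_ ∷_) ([p─q]∪q≡p p q (drop-∷-⊆ q⊆p))

p─p≡⊥ : (p : Subset n) → p ─ p ≡ ⊥
p─p≡⊥ p = ≡.trans (cong (p ─_) (≡.sym (p─⊥≡p p))) (p─[p─q]≡q p ⊥ ⊥⊆)

-- The hypothesis makes `r` and `q` disjoint. It takes this form because an inner sum over the
-- subsets of `E ─ A` supplies exactly such an inclusion.
∣r∪q∣≡∣r∣+∣q∣ : (p q r : Subset n) → r ⊆ p ─ q → ∣ r ∪ q ∣ ≡ ∣ r ∣ ℕ.+ ∣ q ∣
∣r∪q∣≡∣r∣+∣q∣ []      []            []            _ = refl
∣r∪q∣≡∣r∣+∣q∣ (s ∷ p) (outside ∷ q) (outside ∷ r) h = ∣r∪q∣≡∣r∣+∣q∣ p q r (drop-∷-⊆ h)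
∣r∪q∣≡∣r∣+∣q∣ (s ∷ p) (outside ∷ q) (inside ∷ r)  h = cong suc (∣r∪q∣≡∣r∣+∣q∣ p q r (drop-∷-⊆ h))
∣r∪q∣≡∣r∣+∣q∣ (s ∷ p) (inside ∷ q)  (outside ∷ r) h =
  ≡.trans (cong suc (∣r∪q∣≡∣r∣+∣q∣ p q r (drop-∷-⊆ h))) (≡.sym (ℕ.+-suc _ _))
∣r∪q∣≡∣r∣+∣q∣ (s ∷ p) (inside ∷ q)  (inside ∷ r)  h = contradiction (h here) λ ()

∣p─q∣+∣q∣≡∣p∣ : (p q : Subset n) → q ⊆ p → ∣ p ─ q ∣ ℕ.+ ∣ q ∣ ≡ ∣ p ∣
∣p─q∣+∣q∣≡∣p∣ p q q⊆p =
  ≡.trans (≡.sym (∣r∪q∣≡∣r∣+∣q∣ p q (p ─ q) id)) (cong ∣_∣ ([p─q]∪q≡p p q q⊆p))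

-- Parity

infix 4 _≡₂_

-- The witness is explicit and doubled by addition: a parity claim then reduces to a ring identity,
-- and its sign to a square.
_≡₂_ : ℤ → ℤ → Set
i ≡₂ j = ∃ λ m → i ≡ j ℤ.+ (m ℤ.+ m)

2∣k⇒k*c≡₂0 : ∀ {k} → 2 ∣ k → ∀ c → + (k ℕ.* c) ≡₂ 0ℤ
2∣k⇒k*c≡₂0 (divides q refl) c = + (q ℕ.* c) , cong +_ (double q c)
  where
  double : ∀ q c → q ℕ.* 2 ℕ.* c ≡ q ℕ.* c ℕ.+ q ℕ.* c
  double = ℕSolver.solve-∀

-- Odd k is 1 + 2q with q = `k / 2`. Hence (-1)^(k|C|) is already the alternating sign (-1)^|C| when
-- k is odd; when k is even it is trivial.
2∤k⇒k*c≡₂c : ∀ {k} → 2 ∤ k → ∀ c → + (k ℕ.* c) ≡₂ + c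
2∤k⇒k*c≡₂c {k} 2∤k c with k % 2 in k%2≡ | m%n<n k 2 | m≡m%n+[m/n]*n k 2
... | 0           | _                         | _  = contradiction (m%n≡0⇒n∣m k 2 k%2≡) 2∤k
... | 1           | _                         | eq =
  + (k / 2 ℕ.* c) , cong +_ (≡.trans (cong (ℕ._* c) eq) (odd (k / 2) c))
  where
  odd : ∀ q c → (1 ℕ.+ q ℕ.* 2) ℕ.* c ≡ c ℕ.+ (q ℕ.* c ℕ.+ q ℕ.* c)
  odd = ℕSolver.solve-∀
... | suc (suc _) | ℕ.s≤s (ℕ.s≤s ()) | _

module _ {c ℓ} (R : CommutativeRing c ℓ) where
  open CommutativeRing R hiding (zero) renaming (refl to ≈-refl)
  open Polynomials R
  open CommutativeExp commutativeSemiring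
    using (^-congˡ; ^-homo-*; ^-distrib-*)
  open CommutativeSemigroupProperties *-commutativeSemigroup
    using () renaming (interchange to *-interchange; xy∙z≈y∙xz to xy*z≈y*xz)
  open CommutativeSemigroupProperties +-commutativeSemigroup
    using () renaming (interchange to +-interchange)
  open GroupProperties +-group
    using () renaming (⁻¹-involutive to -‿involutive; //-rightDividesˡ to [x-y]+y≈x)
  open AbelianGroupProperties +-abelianGroup
    using () renaming (⁻¹-∙-comm to -‿+-comm)
  open RingProperties ring using (-1*x≈-x)
  open SetoidReasoning setoid

  -- Sums over the subsets of a set

  ∑⊆-cong : ∀ (E : Subset n) {f g} → (∀ A → A ⊆ E → f A ≈ g A) → ∑⊆ E f ≈ ∑⊆ E g
  ∑⊆-cong []            f≈g = f≈g [] id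
  ∑⊆-cong (outside ∷ E) f≈g = ∑⊆-cong E λ A A⊆E → f≈g (outside ∷ A) (s⊆s A⊆E)
  ∑⊆-cong (inside ∷ E)  f≈g = +-cong
    (∑⊆-cong E λ A A⊆E → f≈g (outside ∷ A) (out⊆ A⊆E))
    (∑⊆-cong E λ A A⊆E → f≈g (inside ∷ A) (s⊆s A⊆E))

  ∑⊆-+ : ∀ (E : Subset n) f g → ∑⊆ E (λ A → f A + g A) ≈ ∑⊆ E f + ∑⊆ E g
  ∑⊆-+ []            f g = ≈-refl
  ∑⊆-+ (outside ∷ E) f g = ∑⊆-+ E _ _
  ∑⊆-+ (inside ∷ E)  f g = trans (+-cong (∑⊆-+ E _ _) (∑⊆-+ E _ _)) (+-interchange _ _ _ _)

  ∑⊆-‿ : ∀ (E : Subset n) f → ∑⊆ E (λ A → - f A) ≈ - ∑⊆ E f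
  ∑⊆-‿ []            f = ≈-refl
  ∑⊆-‿ (outside ∷ E) f = ∑⊆-‿ E _
  ∑⊆-‿ (inside ∷ E)  f = trans (+-cong (∑⊆-‿ E _) (∑⊆-‿ E _)) (-‿+-comm _ _)

  ∑⊆-- : ∀ (E : Subset n) f g → ∑⊆ E (λ A → f A - g A) ≈ ∑⊆ E f - ∑⊆ E g
  ∑⊆-- E f g = trans (∑⊆-+ E f (-_ ∘ g)) (+-congˡ (∑⊆-‿ E g))

  *-distribˡ-∑⊆ : ∀ (E : Subset n) a f → a * ∑⊆ E f ≈ ∑⊆ E (λ A → a * f A)
  *-distribˡ-∑⊆ []            a f = ≈-refl
  *-distribˡ-∑⊆ (outside ∷ E) a f = *-distribˡ-∑⊆ E a _
  *-distribˡ-∑⊆ (inside ∷ E)  a f =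
    trans (distribˡ a _ _) (+-cong (*-distribˡ-∑⊆ E a _) (*-distribˡ-∑⊆ E a _))

  ∑⊆-*-∑⊆ : ∀ (E F : Subset n) f g →
            ∑⊆ E f * ∑⊆ F g ≈ ∑⊆ E (λ A → ∑⊆ F (λ B → f A * g B))
  ∑⊆-*-∑⊆ E F f g = begin
    ∑⊆ E f * ∑⊆ F g                     ≈⟨ *-comm _ _ ⟩
    ∑⊆ F g * ∑⊆ E f                     ≈⟨ *-distribˡ-∑⊆ E _ f ⟩
    ∑⊆ E (λ A → ∑⊆ F g * f A)           ≈⟨ ∑⊆-cong E (λ A _ → *-comm _ _) ⟩
    ∑⊆ E (λ A → f A * ∑⊆ F g)           ≈⟨ ∑⊆-cong E (λ A _ → *-distribˡ-∑⊆ F (f A) g) ⟩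
    ∑⊆ E (λ A → ∑⊆ F (λ B → f A * g B)) ∎

  -- Complementing the head element swaps the two halves of the sum.
  ∑⊆-complement : ∀ (E : Subset n) f → ∑⊆ E f ≈ ∑⊆ E (λ A → f (E ─ A))
  ∑⊆-complement []            f = ≈-refl
  ∑⊆-complement (outside ∷ E) f = ∑⊆-complement E _
  ∑⊆-complement (inside ∷ E)  f =
    trans (+-comm _ _) (+-cong (∑⊆-complement E _) (∑⊆-complement E _))

  -- Signs

  sgn : ℤ → Carrier
  sgn i = (- 1#) ^ℤ i

  -1*-1≈1 : - 1# * - 1# ≈ 1#
  -1*-1≈1 = trans (-1*x≈-x _) (-‿involutive 1#)

  -- The mixed-sign case of `sgn-+`. Lowering both numbers by one keeps their difference and removes
  -- the factor (-1)(-1) = 1.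
  sgn-⊖ : ∀ m n → sgn (m ℤ.⊖ n) ≈ (- 1#) ^ m * (- 1#) ^ n
  sgn-⊖ zero    zero    = sym (*-identityˡ _)
  sgn-⊖ zero    (suc n) = sym (*-identityˡ _)
  sgn-⊖ (suc m) zero    = sym (*-identityʳ _)
  sgn-⊖ (suc m) (suc n) = begin
    sgn (suc m ℤ.⊖ suc n)                    ≡⟨ cong sgn (ℤ.[1+m]⊖[1+n]≡m⊖n m n) ⟩
    sgn (m ℤ.⊖ n)                            ≈⟨ sgn-⊖ m n ⟩
    (- 1#) ^ m * (- 1#) ^ n                  ≈⟨ *-identityˡ _ ⟨
    1# * ((- 1#) ^ m * (- 1#) ^ n)           ≈⟨ *-congʳ -1*-1≈1 ⟨
    - 1# * - 1# * ((- 1#) ^ m * (- 1#) ^ n)  ≈⟨ *-interchange _ _ _ _ ⟩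
    (- 1#) ^ suc m * (- 1#) ^ suc n          ∎

  -- Although `_^ℤ_` takes absolute values, for the base `- 1#` only the parity of the exponent
  -- matters, and |i| has the parity of i. Signs can therefore be computed with arbitrary integer
  -- exponents.
  sgn-+ : ∀ i j → sgn (i ℤ.+ j) ≈ sgn i * sgn j
  sgn-+ (+ m)    (+ n)    = ^-homo-* _ m n
  sgn-+ (+ m)    -[1+ n ] = sgn-⊖ m (suc n)
  sgn-+ -[1+ m ] (+ n)    = trans (sgn-⊖ n (suc m)) (*-comm _ _)
  sgn-+ -[1+ m ] -[1+ n ] = begin
    sgn (-[1+ m ] ℤ.+ -[1+ n ])              ≡⟨ cong ((- 1#) ^_) (≡.sym (ℕ.+-suc (suc m) n)) ⟩
    (- 1#) ^ (suc m ℕ.+ suc n)               ≈⟨ ^-homo-* _ (suc m) (suc n) ⟩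
    (- 1#) ^ suc m * (- 1#) ^ suc n          ∎

  sgn-double : ∀ m → sgn (m ℤ.+ m) ≈ 1#
  sgn-double m = trans (sgn-+ m m) (square ℤ.∣ m ∣)
    where
    square : ∀ n → (- 1#) ^ n * (- 1#) ^ n ≈ 1#
    square zero    = *-identityˡ 1#
    square (suc n) = trans (*-interchange _ _ _ _)
      (trans (*-cong -1*-1≈1 (square n)) (*-identityˡ 1#))

  sgn-cong : ∀ i j → i ≡₂ j → sgn i ≈ sgn j
  sgn-cong i j (m , i≡) = begin
    sgn i                    ≡⟨ cong sgn i≡ ⟩
    sgn (j ℤ.+ (m ℤ.+ m))    ≈⟨ sgn-+ j (m ℤ.+ m) ⟩
    sgn j * sgn (m ℤ.+ m)    ≈⟨ *-congˡ (sgn-double m) ⟩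
    sgn j * 1#               ≈⟨ *-identityʳ _ ⟩
    sgn j                    ∎

  [-x]^ℤ : ∀ x i → (- x) ^ℤ i ≈ sgn i * x ^ℤ i
  [-x]^ℤ x i = trans (^-congˡ ℤ.∣ i ∣ (sym (-1*x≈-x x))) (^-distrib-* (- 1#) x ℤ.∣ i ∣)

  -- The shape of a term of a signed `χ` at `- x`: the prefactor, the sign of the subset and the
  -- sign hidden in the power of `- x` merge into one exponent.
  sgn-*-sgn-*-[-x]^ℤ : ∀ x i j l →
    sgn i * (sgn j * (- x) ^ℤ l) ≈ sgn (i ℤ.+ (j ℤ.+ l)) * x ^ℤ l
  sgn-*-sgn-*-[-x]^ℤ x i j l = begin
    sgn i * (sgn j * (- x) ^ℤ l)             ≈⟨ *-congˡ (*-congˡ ([-x]^ℤ x l)) ⟩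
    sgn i * (sgn j * (sgn l * x ^ℤ l))       ≈⟨ *-congˡ (*-assoc _ _ _) ⟨
    sgn i * (sgn j * sgn l * x ^ℤ l)         ≈⟨ *-assoc _ _ _ ⟨
    sgn i * (sgn j * sgn l) * x ^ℤ l         ≈⟨ *-congʳ (*-congˡ (sgn-+ j l)) ⟨
    sgn i * sgn (j ℤ.+ l) * x ^ℤ l           ≈⟨ *-congʳ (sgn-+ i (j ℤ.+ l)) ⟨
    sgn (i ℤ.+ (j ℤ.+ l)) * x ^ℤ l           ∎

  -- Alternating sums over chains of subsets.

  -- The pairs A, C stand for the chains B ⊆ A ⊆ D with D = C ∪ A, so |C| = |D| − |A|.
  ∑-alternating : ∀ (E : Subset n) (h : Subset n → Subset n → Carrier) →
    ∑⊆ E (λ A → ∑⊆ A λ B → ∑⊆ (E ─ A) λ C → sgn (+ ∣ C ∣) * h B (C ∪ A))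
      ≈ ∑⊆ E (λ B → h B B)
  ∑-alternating []            h = *-identityˡ _
  ∑-alternating (outside ∷ E) h = ∑-alternating E λ B D → h (outside ∷ B) (outside ∷ D)
  ∑-alternating {suc n} (inside ∷ E) h = begin
    -- Split on the new element. If A omits it, so does B, while C may take it, putting it into D at
    -- the cost of a factor `- 1#`. If A contains it, C omits it, D contains it and B is free. The
    -- letters of `oo`, `oi`, `ii` say whether B and D contain it; the two `oi` sums cancel.
    ∑⊆ E (λ A → ∑⊆ A λ B → X oo A B + ∑⊆ (E ─ A) λ C → - 1# * sgn (+ ∣ C ∣) * oi B (C ∪ A))
      + ∑⊆ E (λ A → ∑⊆ A (X oi A) + ∑⊆ A (X ii A))
        ≈⟨ +-cong
             (∑⊆-cong E λ A _ → trans
               (∑⊆-cong A λ B _ → +-congˡ (trans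
                 (∑⊆-cong (E ─ A) λ C _ → trans (*-assoc _ _ _) (-1*x≈-x _))
                 (∑⊆-‿ (E ─ A) _)))
               (∑⊆-- A (X oo A) (X oi A)))
             (∑⊆-+ E _ _) ⟩
    ∑⊆ E (λ A → ∑⊆ A (X oo A) - ∑⊆ A (X oi A)) + (∑X oi + ∑X ii)
        ≈⟨ +-congʳ (∑⊆-- E _ _) ⟩
    (∑X oo - ∑X oi) + (∑X oi + ∑X ii)
        ≈⟨ +-assoc _ _ _ ⟨
    (∑X oo - ∑X oi) + ∑X oi + ∑X ii
        ≈⟨ +-congʳ ([x-y]+y≈x (∑X oi) (∑X oo)) ⟩
    ∑X oo + ∑X ii
        ≈⟨ +-cong (∑-alternating E oo) (∑-alternating E ii) ⟩
    ∑⊆ E (λ B → oo B B) + ∑⊆ E (λ B → ii B B) ∎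
    where
    oo oi ii : Subset n → Subset n → Carrier
    oo B D = h (outside ∷ B) (outside ∷ D)
    oi B D = h (outside ∷ B) (inside ∷ D)
    ii B D = h (inside ∷ B) (inside ∷ D)

    X : (Subset n → Subset n → Carrier) → Subset n → Subset n → Carrier
    X g A B = ∑⊆ (E ─ A) λ C → sgn (+ ∣ C ∣) * g B (C ∪ A)

    ∑X : (Subset n → Subset n → Carrier) → Carrier
    ∑X g = ∑⊆ E λ A → ∑⊆ A (X g A)

  -- The exponents `u` and `v` together must give `∣ C ∣` modulo 2, up to a remainder `w` that sees
  -- only B and D = `C ∪ A`. Such a remainder can be absorbed into the `h` of `∑-alternating`; its
  -- evenness for B = D leaves the surviving terms without sign.
  ∑-convolution : ∀ (E : Subset n) (u v w : Subset n → Subset n → ℤ) (a b : Subset n → Carrier) →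
    (∀ A B C → A ⊆ E → B ⊆ A → C ⊆ E ─ A → u A B ℤ.+ v A C ≡₂ + ∣ C ∣ ℤ.+ w B (C ∪ A)) →
    (∀ B → w B B ≡₂ 0ℤ) →
    ∑⊆ E (λ A → ∑⊆ A (λ B → sgn (u A B) * b B) * ∑⊆ (E ─ A) (λ C → sgn (v A C) * a (C ∪ A)))
      ≈ ∑⊆ E (λ B → a B * b B)
  ∑-convolution E u v w a b uv≡ w≡0 = begin
    ∑⊆ E (λ A → ∑⊆ A (λ B → sgn (u A B) * b B) * ∑⊆ (E ─ A) (λ C → sgn (v A C) * a (C ∪ A)))
      ≈⟨ ∑⊆-cong E (λ A A⊆E → trans (∑⊆-*-∑⊆ A (E ─ A) _ _)
           (∑⊆-cong A λ B B⊆A → ∑⊆-cong (E ─ A) λ C C⊆ → term A B C A⊆E B⊆A C⊆)) ⟩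
    ∑⊆ E (λ A → ∑⊆ A λ B → ∑⊆ (E ─ A) λ C → sgn (+ ∣ C ∣) * h B (C ∪ A))
      ≈⟨ ∑-alternating E h ⟩
    ∑⊆ E (λ B → h B B)
      ≈⟨ ∑⊆-cong E (λ B _ → trans (*-congʳ (sgn-cong (w B B) 0ℤ (w≡0 B))) (*-identityˡ _)) ⟩
    ∑⊆ E (λ B → a B * b B) ∎
    where
    h : Subset _ → Subset _ → Carrier
    h B D = sgn (w B D) * (a D * b B)

    term : ∀ A B C → A ⊆ E → B ⊆ A → C ⊆ E ─ A →
      sgn (u A B) * b B * (sgn (v A C) * a (C ∪ A)) ≈ sgn (+ ∣ C ∣) * h B (C ∪ A)
    term A B C A⊆E B⊆A C⊆ = begin
      sgn (u A B) * b B * (sgn (v A C) * a (C ∪ A))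
        ≈⟨ *-interchange _ _ _ _ ⟩
      sgn (u A B) * sgn (v A C) * (b B * a (C ∪ A))
        ≈⟨ *-cong (sgn-+ (u A B) (v A C)) (*-comm _ _) ⟨
      sgn (u A B ℤ.+ v A C) * (a (C ∪ A) * b B)
        ≈⟨ *-congʳ (sgn-cong _ (+ ∣ C ∣ ℤ.+ w B (C ∪ A)) (uv≡ A B C A⊆E B⊆A C⊆)) ⟩
      sgn (+ ∣ C ∣ ℤ.+ w B (C ∪ A)) * (a (C ∪ A) * b B)
        ≈⟨ *-congʳ (sgn-+ (+ ∣ C ∣) (w B (C ∪ A))) ⟩
      sgn (+ ∣ C ∣) * sgn (w B (C ∪ A)) * (a (C ∪ A) * b B)
        ≈⟨ *-assoc _ _ _ ⟩
      sgn (+ ∣ C ∣) * h B (C ∪ A) ∎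

  [x+1]-1≈x : ∀ x → x + 1# - 1# ≈ x
  [x+1]-1≈x x = trans (+-assoc x 1# (- 1#)) (trans (+-congˡ (-‿inverseʳ 1#)) (+-identityʳ x))

  -- Terms of `T` and `χ` for restrictions, contractions and duals.

  module _ (k : ℕ) {n : ℕ} (P : RankedSet n) (r∅≡0 : rank P ⊥ ≡ 0ℤ) (x y : Carrier) where
    private
      E = ground P
      r = rank P

    corank nullity : Subset n → Carrier
    corank  D = x ^ℤ (r E ℤ.- r D)
    nullity B = y ^ℤ (+ (k ℕ.* ∣ B ∣) ℤ.- r B)

    T-expansion : T k P (x + 1#) (y + 1#) ≈ ∑⊆ E (λ A → corank A * nullity A)
    T-expansion = ∑⊆-cong E λ A _ →
      *-cong (^-congˡ ℤ.∣ r E ℤ.- r A ∣ ([x+1]-1≈x x))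
             (^-congˡ ℤ.∣ + (k ℕ.* ∣ A ∣) ℤ.- r A ∣ ([x+1]-1≈x y))

    -- At first argument 0 the base becomes -1, so the corank factor degenerates to a sign. In
    -- `T-/ᶜ` the same happens to the nullity factor.
    T-∣ʳ : ∀ A → T k (P ∣ʳ A) 0# (y + 1#) ≈ ∑⊆ A (λ B → sgn (r A ℤ.- r B) * nullity B)
    T-∣ʳ A = ∑⊆-cong A λ B _ →
      *-cong (^-congˡ ℤ.∣ r A ℤ.- r B ∣ (+-identityˡ (- 1#)))
             (^-congˡ ℤ.∣ + (k ℕ.* ∣ B ∣) ℤ.- r B ∣ ([x+1]-1≈x y))

    -- The two subtractions of `r A` cancel, so the power of x depends on A and C only through
    -- `C ∪ A`, as `∑-convolution` requires.
    corank-/ᶜ : ∀ A → A ⊆ E → ∀ C →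
      totalRank (P /ᶜ A) ℤ.- rank (P /ᶜ A) C ≡ r E ℤ.- r (C ∪ A)
    corank-/ᶜ A A⊆E C = ≡.trans (cancel (r ((E ─ A) ∪ A)) (r (C ∪ A)) (r A))
      (cong (λ X → r X ℤ.- r (C ∪ A)) ([p─q]∪q≡p E A A⊆E))
      where
      cancel : ∀ d c a → (d ℤ.- a) ℤ.- (c ℤ.- a) ≡ d ℤ.- c
      cancel = solve-∀

    T-/ᶜ : ∀ A → A ⊆ E → T k (P /ᶜ A) (x + 1#) 0#
      ≈ ∑⊆ (E ─ A) (λ C → sgn (+ (k ℕ.* ∣ C ∣) ℤ.- (r (C ∪ A) ℤ.- r A)) * corank (C ∪ A))
    T-/ᶜ A A⊆E = ∑⊆-cong (E ─ A) λ C _ → trans (*-comm _ _)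
      (*-cong (^-congˡ ℤ.∣ + (k ℕ.* ∣ C ∣) ℤ.- (r (C ∪ A) ℤ.- r A) ∣ (+-identityˡ (- 1#)))
        (trans (^-congˡ ℤ.∣ totalRank (P /ᶜ A) ℤ.- rank (P /ᶜ A) C ∣ ([x+1]-1≈x x))
               (reflexive (cong (x ^ℤ_) (corank-/ᶜ A A⊆E C)))))

    χ-/ᶜ : ∀ A → A ⊆ E → sgn (totalRank (P /ᶜ A)) * χ (P /ᶜ A) (- x)
      ≈ ∑⊆ (E ─ A) (λ C →
          sgn (r E ℤ.- r A ℤ.+ (+ ∣ C ∣ ℤ.+ (r E ℤ.- r (C ∪ A)))) * corank (C ∪ A))
    χ-/ᶜ A A⊆E = trans (*-distribˡ-∑⊆ (E ─ A) _ _) (∑⊆-cong (E ─ A) λ C _ → begin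
      sgn (r ((E ─ A) ∪ A) ℤ.- r A)
        * (sgn (+ ∣ C ∣) * (- x) ^ℤ (totalRank (P /ᶜ A) ℤ.- rank (P /ᶜ A) C))
          ≡⟨ cong₂ (λ X i → sgn (r X ℤ.- r A) * (sgn (+ ∣ C ∣) * (- x) ^ℤ i))
               ([p─q]∪q≡p E A A⊆E) (corank-/ᶜ A A⊆E C) ⟩
      sgn (r E ℤ.- r A) * (sgn (+ ∣ C ∣) * (- x) ^ℤ (r E ℤ.- r (C ∪ A)))
          ≈⟨ sgn-*-sgn-*-[-x]^ℤ x (r E ℤ.- r A) (+ ∣ C ∣) (r E ℤ.- r (C ∪ A)) ⟩
      sgn (r E ℤ.- r A ℤ.+ (+ ∣ C ∣ ℤ.+ (r E ℤ.- r (C ∪ A)))) * corank (C ∪ A) ∎)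

    -- Duality turns corank into nullity of the complement: r*(A) = k|A| - r(A), using `r∅≡0`, and
    -- r*(A ─ B) = k|A ─ B| + r(B) - r(A).
    corank-dual : ∀ A B → B ⊆ A →
      totalRank (dual k (P ∣ʳ A)) ℤ.- rank (dual k (P ∣ʳ A)) (A ─ B) ≡ + (k ℕ.* ∣ B ∣) ℤ.- r B
    corank-dual A B B⊆A = ≡.trans
      (cong₂ ℤ._-_
        (cong₂ (λ m i → + m ℤ.+ i ℤ.- r A) k∣A∣ (≡.trans (cong r (p─p≡⊥ A)) r∅≡0))
        (cong (λ X → + (k ℕ.* ∣ A ─ B ∣) ℤ.+ r X ℤ.- r A) (p─[p─q]≡q A B B⊆A)))
      (cancel (+ (k ℕ.* ∣ A ─ B ∣)) (+ (k ℕ.* ∣ B ∣)) (r A) (r B))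
      where
      k∣A∣ : k ℕ.* ∣ A ∣ ≡ k ℕ.* ∣ A ─ B ∣ ℕ.+ k ℕ.* ∣ B ∣
      k∣A∣ = ≡.trans (cong (k ℕ.*_) (≡.sym (∣p─q∣+∣q∣≡∣p∣ A B B⊆A)))
                     (ℕ.*-distribˡ-+ k ∣ A ─ B ∣ ∣ B ∣)

      cancel : ∀ c b i j → (c ℤ.+ b ℤ.+ 0ℤ ℤ.- i) ℤ.- (c ℤ.+ j ℤ.- i) ≡ b ℤ.- j
      cancel = solve-∀

    -- Summing over complements `A ─ B` makes the power of -y the nullity of B, while the sign of
    -- the term remains (-1)^|A ─ B|.
    χ-dual : ∀ A → sgn (totalRank (P ∣ʳ A)) * χ (dual k (P ∣ʳ A)) (- y)
      ≈ ∑⊆ A (λ B →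
          sgn (r A ℤ.+ (+ ∣ A ─ B ∣ ℤ.+ (+ (k ℕ.* ∣ B ∣) ℤ.- r B))) * nullity B)
    χ-dual A = begin
      sgn (r A) * χ (dual k (P ∣ʳ A)) (- y)
        ≈⟨ *-congˡ (∑⊆-complement A _) ⟩
      sgn (r A) * ∑⊆ A (λ B → sgn (+ ∣ A ─ B ∣) *
          (- y) ^ℤ (totalRank (dual k (P ∣ʳ A)) ℤ.- rank (dual k (P ∣ʳ A)) (A ─ B)))
        ≈⟨ *-distribˡ-∑⊆ A _ _ ⟩
      ∑⊆ A (λ B → sgn (r A) * (sgn (+ ∣ A ─ B ∣) *
          (- y) ^ℤ (totalRank (dual k (P ∣ʳ A)) ℤ.- rank (dual k (P ∣ʳ A)) (A ─ B))))
        ≈⟨ ∑⊆-cong A (λ B B⊆A → trans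
             (reflexive (cong (λ i → sgn (r A) * (sgn (+ ∣ A ─ B ∣) * (- y) ^ℤ i))
               (corank-dual A B B⊆A)))
             (sgn-*-sgn-*-[-x]^ℤ y (r A) (+ ∣ A ─ B ∣) (+ (k ℕ.* ∣ B ∣) ℤ.- r B))) ⟩
      ∑⊆ A (λ B → sgn (r A ℤ.+ (+ ∣ A ─ B ∣ ℤ.+ (+ (k ℕ.* ∣ B ∣) ℤ.- r B))) * nullity B) ∎

    -- The three convolution formulas.

    T-convolution-odd : 2 ∤ k → T k P (x + 1#) (y + 1#)
      ≈ ∑⊆ E (λ A → T k (P ∣ʳ A) 0# (y + 1#) * T k (P /ᶜ A) (x + 1#) 0#)
    T-convolution-odd 2∤k = trans T-expansion (sym (trans
      (∑⊆-cong E λ A A⊆E → *-cong (T-∣ʳ A) (T-/ᶜ A A⊆E))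
      (∑-convolution E
        (λ A B → r A ℤ.- r B)
        (λ A C → + (k ℕ.* ∣ C ∣) ℤ.- (r (C ∪ A) ℤ.- r A))
        -- Both factors contribute `r A`, which drops out modulo 2, and k|C| contributes |C|.
        (λ B D → ℤ.- (r B ℤ.+ r D))
        corank nullity
        (λ A B C A⊆E B⊆A C⊆ → parity (r A) (r B) (r (C ∪ A)) (+ ∣ C ∣) (2∤k⇒k*c≡₂c 2∤k ∣ C ∣))
        (λ B → ℤ.- r B , diagonal (r B)))))
      where
      diagonal : ∀ b → ℤ.- (b ℤ.+ b) ≡ 0ℤ ℤ.+ (ℤ.- b ℤ.+ ℤ.- b)
      diagonal = solve-∀

      parity : ∀ a b d c {kc} → kc ≡₂ c →
        (a ℤ.- b) ℤ.+ (kc ℤ.- (d ℤ.- a)) ≡₂ c ℤ.+ ℤ.- (b ℤ.+ d)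
      parity a b d c (m , refl) = a ℤ.+ m , identity a b c d m
        where
        identity : ∀ a b c d m → (a ℤ.- b) ℤ.+ (c ℤ.+ (m ℤ.+ m) ℤ.- (d ℤ.- a))
          ≡ c ℤ.+ ℤ.- (b ℤ.+ d) ℤ.+ ((a ℤ.+ m) ℤ.+ (a ℤ.+ m))
        identity = solve-∀

    χ*-T-convolution-even : 2 ∣ k → T k P (x + 1#) (y + 1#)
      ≈ ∑⊆ E (λ A →
          sgn (totalRank (P ∣ʳ A)) * χ (dual k (P ∣ʳ A)) (- y) * T k (P /ᶜ A) (x + 1#) 0#)
    χ*-T-convolution-even 2∣k = trans T-expansion (sym (trans
      (∑⊆-cong E λ A A⊆E → *-cong (χ-dual A) (T-/ᶜ A A⊆E))
      (∑-convolution E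
        (λ A B → r A ℤ.+ (+ ∣ A ─ B ∣ ℤ.+ (+ (k ℕ.* ∣ B ∣) ℤ.- r B)))
        (λ A C → + (k ℕ.* ∣ C ∣) ℤ.- (r (C ∪ A) ℤ.- r A))
        -- Since |D| = |C| + |A ─ B| + |B|, the sign (-1)^|A ─ B| from `χ` of the dual equals
        -- (-1)^|C| up to the factor (-1)^(|B| + |D|). The multiples of k are even.
        (λ B D → + ∣ B ∣ ℤ.+ + ∣ D ∣ ℤ.- (r B ℤ.+ r D))
        corank nullity
        (λ A B C A⊆E B⊆A C⊆ → parity (r A) (r B) (r (C ∪ A)) (+ ∣ A ─ B ∣) (+ ∣ B ∣) (+ ∣ C ∣)
          (2∣k⇒k*c≡₂0 2∣k ∣ B ∣) (2∣k⇒k*c≡₂0 2∣k ∣ C ∣)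
          (cong +_ (≡.trans (∣r∪q∣≡∣r∣+∣q∣ E A C C⊆)
            (cong (∣ C ∣ ℕ.+_) (≡.sym (∣p─q∣+∣q∣≡∣p∣ A B B⊆A))))))
        (λ B → + ∣ B ∣ ℤ.- r B , diagonal (+ ∣ B ∣) (r B)))))
      where
      diagonal : ∀ s b → s ℤ.+ s ℤ.- (b ℤ.+ b) ≡ 0ℤ ℤ.+ ((s ℤ.- b) ℤ.+ (s ℤ.- b))
      diagonal = solve-∀

      parity : ∀ a b d ∣A─B∣ ∣B∣ ∣C∣ {∣D∣ kb kc} → kb ≡₂ 0ℤ → kc ≡₂ 0ℤ →
        ∣D∣ ≡ ∣C∣ ℤ.+ (∣A─B∣ ℤ.+ ∣B∣) →
        (a ℤ.+ (∣A─B∣ ℤ.+ (kb ℤ.- b))) ℤ.+ (kc ℤ.- (d ℤ.- a))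
          ≡₂ ∣C∣ ℤ.+ (∣B∣ ℤ.+ ∣D∣ ℤ.- (b ℤ.+ d))
      parity a b d s t u (m , refl) (l , refl) refl =
        a ℤ.+ m ℤ.+ l ℤ.- t ℤ.- u , identity a b d s t u m l
        where
        identity : ∀ a b d s t u m l →
          (a ℤ.+ (s ℤ.+ (0ℤ ℤ.+ (m ℤ.+ m) ℤ.- b))) ℤ.+ (0ℤ ℤ.+ (l ℤ.+ l) ℤ.- (d ℤ.- a))
          ≡ u ℤ.+ (t ℤ.+ (u ℤ.+ (s ℤ.+ t)) ℤ.- (b ℤ.+ d))
            ℤ.+ ((a ℤ.+ m ℤ.+ l ℤ.- t ℤ.- u) ℤ.+ (a ℤ.+ m ℤ.+ l ℤ.- t ℤ.- u))
        identity = solve-∀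

    T-χ-convolution : T k P (x + 1#) (y + 1#)
      ≈ ∑⊆ E (λ A →
          sgn (totalRank (P /ᶜ A)) * T k (P ∣ʳ A) 0# (y + 1#) * χ (P /ᶜ A) (- x))
    T-χ-convolution = trans T-expansion (sym (trans
      -- The sign (-1)^r(P/A) is first moved next to `χ`.
      (∑⊆-cong E λ A A⊆E → trans (xy*z≈y*xz _ _ _) (*-cong (T-∣ʳ A) (χ-/ᶜ A A⊆E)))
      (∑-convolution E
        (λ A B → r A ℤ.- r B)
        (λ A C → r E ℤ.- r A ℤ.+ (+ ∣ C ∣ ℤ.+ (r E ℤ.- r (C ∪ A))))
        (λ B D → ℤ.- (r B ℤ.+ r D))
        corank nullity
        -- The terms `r A` cancel exactly and |C| comes from the definition of `χ`. The witness is
        -- `r E` because it occurs twice, in the prefactor and in the power of -x.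
        (λ A B C A⊆E B⊆A C⊆ → r E , parity (r A) (r B) (+ ∣ C ∣) (r (C ∪ A)) (r E))
        (λ B → ℤ.- r B , diagonal (r B)))))
      where
      diagonal : ∀ b → ℤ.- (b ℤ.+ b) ≡ 0ℤ ℤ.+ (ℤ.- b ℤ.+ ℤ.- b)
      diagonal = solve-∀

      parity : ∀ a b c d e → (a ℤ.- b) ℤ.+ (e ℤ.- a ℤ.+ (c ℤ.+ (e ℤ.- d)))
        ≡ c ℤ.+ ℤ.- (b ℤ.+ d) ℤ.+ (e ℤ.+ e)
      parity = solve-∀

theorem3p13 : ∀ {c ℓ} (R : CommutativeRing c ℓ) →
    let open CommutativeRing R
        open Polynomials R
    in
    ∀ (k : ℕ) → 1 ≤ k →
    ∀ {n} (P : RankedSet n) → IsKPolymatroid k P →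
    ∀ (x y : Carrier) →
    (2 ∤ k →
      T k P (x + 1#) (y + 1#)
        ≈ ∑⊆ (ground P) (λ A → T k (P ∣ʳ A) 0# (y + 1#) * T k (P /ᶜ A) (x + 1#) 0#))
    ×
    (2 ∣ k →
      (T k P (x + 1#) (y + 1#)
        ≈ ∑⊆ (ground P) (λ A →
            (- 1#) ^ℤ totalRank (P ∣ʳ A) * χ (dual k (P ∣ʳ A)) (- y) * T k (P /ᶜ A) (x + 1#) 0#))
      ×
      (T k P (x + 1#) (y + 1#)
        ≈ ∑⊆ (ground P) (λ A →
            (- 1#) ^ℤ totalRank (P /ᶜ A) * T k (P ∣ʳ A) 0# (y + 1#) * χ (P /ᶜ A) (- x))))
theorem3p13 R k _ P isK x y =
    T-convolution-odd R k P rank-∅ x y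
  , λ 2∣k → χ*-T-convolution-even R k P rank-∅ x y 2∣k
          , T-χ-convolution R k P rank-∅ x y
  where open IsKPolymatroid isK using (rank-∅)
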